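{- $\mu(n)=4$ for every $n\in\{5,6,\dots,12\}$.
   Context: A matroid on a finite set $S$ is a family $\mathcal{M}$ of subsets of $S$ with $\emptyset\in\mathcal{M}$, closed under subsets, such that for every $A\subseteq S$ all maximal members of $\mathcal{M}$ contained in $A$ have the same cardinality. For a finite simple graph $G=(V,E)$, $M(G)$ is the family of all matchings (sets of pairwise disjoint edges) of $G$, and $\mu(G)$ is the minimum $m\in\mathbb{N}$ such that $M(G)$ is the intersection $\mathcal{M}_1\cap\dots\cap\mathcal{M}_m$ of $m$ matroids on $E$. For $n\in\mathbb{N}$, $\mu(n)=\max\{\mu(G): G \text{ a finite simple graph with } |V|\le n\}$. -}

module Defs where

open import Data.Nat as ℕ using (ℕ; _≤_)
open import Data.Fin as Fin using (Fin)
open import Data.Fin.Subset using (Subset; ⊥; _⊆_; _∈_; ∣_∣)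
open import Data.Product using (Σ; _×_; _,_; proj₁; proj₂; ∃)
open import Relation.Binary.PropositionalEquality using (_≡_; _≢_)
open import Relation.Nullary using (¬_)
open import Level using (Level; suc; zero)

-- A finite simple graph with vertex set Fin v and edge set indexed by Fin m.
-- Edge e joins ends e = (a , b) with a < b (so loops are impossible and each
-- unordered pair is stored in a canonical order); distinct edge indices give
-- distinct pairs (no multiple edges).
record Graph : Set where
  field
    v    : ℕ
    m    : ℕ
    ends : Fin m → Fin v × Fin v
    ordered : ∀ e → proj₁ (ends e) Fin.< proj₂ (ends e)
    simple  : ∀ e f → ends e ≡ ends f → e ≡ f
open Graph public

Family : ℕ → Set₁
Family k = Subset k → Set

MaximalIn : ∀ {k} → Family k → Subset k → Subset k → Set
MaximalIn 𝓜 A X = X ⊆ A × 𝓜 X × (∀ Z → X ⊆ Z → Z ⊆ A → 𝓜 Z → Z ≡ X)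

record IsMatroid {k : ℕ} (𝓜 : Family k) : Set where
  field
    empty   : 𝓜 ⊥
    down    : ∀ X Y → Y ⊆ X → 𝓜 X → 𝓜 Y
    equicard : ∀ A X Y → MaximalIn 𝓜 A X → MaximalIn 𝓜 A Y → ∣ X ∣ ≡ ∣ Y ∣

Disjoint : (G : Graph) → Fin (m G) → Fin (m G) → Set
Disjoint G e f =
  proj₁ (ends G e) ≢ proj₁ (ends G f) × proj₁ (ends G e) ≢ proj₂ (ends G f) ×
  proj₂ (ends G e) ≢ proj₁ (ends G f) × proj₂ (ends G e) ≢ proj₂ (ends G f)

IsMatching : (G : Graph) → Family (m G)
IsMatching G S = ∀ e f → e ∈ S → f ∈ S → e ≢ f → Disjoint G e f

IntersectionOf : (G : Graph) → ℕ → Set₁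
IntersectionOf G j =
  Σ (Fin j → Family (m G)) λ 𝓜 →
    (∀ i → IsMatroid (𝓜 i)) ×
    (∀ S → (IsMatching G S → ∀ i → 𝓜 i S) × ((∀ i → 𝓜 i S) → IsMatching G S))

MuGraph : Graph → ℕ → Set₁
MuGraph G j = IntersectionOf G j × (∀ i → i ℕ.< j → ¬ IntersectionOf G i)

MuN : ℕ → ℕ → Set₁
MuN n j =
  (∀ G → v G ≤ n → Σ ℕ λ i → MuGraph G i × i ≤ j) ×
  (Σ Graph λ G → v G ≤ n × MuGraph G j)

{-# OPTIONS --safe #-}

-- Upper bound.  There are four linear orders on 12 points such that for every
-- x, y, z with x ∉ {y, z} some order puts x above both y and z.  Labelling each
-- edge by its upper end in the i-th order gives a partition matroid, and two
-- distinct edges sharing the vertex x get the same label in an order that puts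
-- x above both other ends; so the four matroids intersect in the matchings.
--
-- Lower bound.  In a matroid containing all matchings of K₅, parallelism is an
-- equivalence relation on edges that never relates disjoint edges.  If three
-- matroids intersect in the matchings, every two adjacent edges are parallel in
-- one of them.  Each matroid has at most one vertex whose whole star is a
-- parallel class, so some edge uv has no such end; the colours of the six pairs
-- containing uv are then determined up to symmetry in two ways, and both lead
-- to parallel disjoint edges.
--
-- Families of sets are arbitrary predicates, so for the existence of a least
-- number of matroids one also needs that "M(G) is an intersection of j matroids"
-- is decidable: up to double negation one may take decidable families, and
-- these are finitely many.
module Submission where

open import Defs
open import Data.Bool using (Bool; true; false; if_then_else_)
open import Data.Empty using () renaming (⊥ to Empty)
open import Data.Fin using (Fin; zero; suc; combine; inject≤; punchIn)
open import Data.Fin.Patterns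
open import Data.Fin.Properties using (_≟_; all?; any?; combine-injective; inject≤-injective; pigeonhole; punchIn-injective; punchInᵢ≢i; sequence; ¬∀⟶∃¬)
import Data.Fin.Properties as Fin
open import Data.Fin.Subset using (Subset; ⊥; ⁅_⁆; _∈_; _⊆_; _∪_; _-_; ∣_∣)
open import Data.Fin.Subset.Properties using (_∈?_; _⊆?_; anySubset?; p⊂q⇒∣p∣<∣q∣; p⊆p∪q; q⊆p∪q; x∈p∪q⁻; x∈p∪q⁺; x∈p∧x≢y⇒x∈p-y; x∈p⇒∣p-x∣<∣p∣; x∈⁅x⁆; x∈⁅y⁆⇒x≡y; ∉⊥; ∣⁅x⁆∣≡1; ⊆-antisym)
open import Data.List using (List; []; _∷_)
open import Data.List.Relation.Unary.Unique.Propositional using (Unique)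
import Data.List.Relation.Unary.Unique.Propositional.Properties as Unique
import Data.List.Relation.Unary.Unique.DecPropositional as DecUnique
open import Data.Nat using (ℕ; zero; suc; _*_; _^_; _≤_; _<_; _<?_; _≤′_; ≤′-reflexive; ≤′-step; z≤n; s≤s; s≤s⁻¹)
open import Data.Nat.Properties using (<-asym; <-irrefl; ≤-antisym; ≤-refl; ≤-trans; ≤-<-trans; ≤⇒≤′; m<1+n⇒m<n∨m≡n; m≤n⇒m≤1+n)
import Data.Nat.Properties as ℕ
open import Data.Product using (Σ; ∃₂; ∃-syntax; _×_; _,_; proj₁; proj₂)
open import Data.Product.Properties using (≡-dec)
open import Data.Sum using (_⊎_; inj₁; inj₂; [_,_])
open import Data.Vec using (Vec; []; _∷_; here; there; lookup; tabulate)
open import Data.Vec.Properties using (lookup∘tabulate; lookup⇒[]=; []=⇒lookup)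
import Data.Vec.Properties as Vec
import Data.Bool.Properties as Bool
open import Effect.Monad using (RawMonad)
open import Function using (_∘_; id)
open import Relation.Binary.PropositionalEquality using (_≡_; _≢_; refl; sym; trans; cong; cong₂; subst)
open import Relation.Nullary using (¬_; Dec; yes; no; does; contradiction; ¬?)
open import Relation.Nullary.Decidable using (True; decidable-stable; dec-true; dec-false; from-yes; map′; toWitness; _×-dec_; _⊎-dec_; _→-dec_; ¬¬-excluded-middle)
open import Relation.Nullary.Negation using (¬¬-Monad)
open import Relation.Unary using (Decidable)

-- Partition matroids

Rainbow : ∀ {m n} → (Fin m → Fin n) → Family m
Rainbow ℓ S = ∀ e f → e ∈ S → f ∈ S → ℓ e ≡ ℓ f → e ≡ f

-- Induction on `X`: the first element is matched with some `y` of the same label, and `y` is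
-- deleted from `Y`. No later element of `X` can want `y`, as labels do not repeat on `X`. The two
-- labellings are separate because the recursion shifts `ℓ` to the tail while `Y` keeps its ground
-- set.
∣X∣≤∣Y∣-by-labels : ∀ {A : Set} {m n} (ℓ : Fin m → A) (ℓ′ : Fin n → A) (X : Subset m) (Y : Subset n) →
  (∀ e f → e ∈ X → f ∈ X → ℓ e ≡ ℓ f → e ≡ f) →
  (∀ e → e ∈ X → ∃[ f ] f ∈ Y × ℓ e ≡ ℓ′ f) → ∣ X ∣ ≤ ∣ Y ∣
∣X∣≤∣Y∣-by-labels ℓ ℓ′ [] Y inj hit = z≤n
∣X∣≤∣Y∣-by-labels ℓ ℓ′ (false ∷ X) Y inj hit =
  ∣X∣≤∣Y∣-by-labels (ℓ ∘ suc) ℓ′ X Y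
    (λ e f e∈X f∈X eq → Fin.suc-injective (inj (suc e) (suc f) (there e∈X) (there f∈X) eq))
    (λ e e∈X → hit (suc e) (there e∈X))
∣X∣≤∣Y∣-by-labels ℓ ℓ′ (true ∷ X) Y inj hit with hit zero here
... | y , y∈Y , ℓ0≡ℓ′y = ≤-<-trans
  (∣X∣≤∣Y∣-by-labels (ℓ ∘ suc) ℓ′ X (Y - y)
    (λ e f e∈X f∈X eq → Fin.suc-injective (inj (suc e) (suc f) (there e∈X) (there f∈X) eq))
    hit′)
  (x∈p⇒∣p-x∣<∣p∣ y∈Y)
  where
  hit′ : ∀ e → e ∈ X → ∃[ f ] f ∈ Y - y × ℓ (suc e) ≡ ℓ′ f
  hit′ e e∈X with hit (suc e) (there e∈X)
  ... | f , f∈Y , ℓe≡ℓ′f = f , x∈p∧x≢y⇒x∈p-y f∈Y f≢y , ℓe≡ℓ′f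
    where
    f≢y : f ≢ y
    f≢y refl with inj (suc e) zero (there e∈X) here (trans ℓe≡ℓ′f (sym ℓ0≡ℓ′y))
    ... | ()

∪⁅⁆-⊆ : ∀ {m} {X A : Subset m} {e} → X ⊆ A → e ∈ A → X ∪ ⁅ e ⁆ ⊆ A
∪⁅⁆-⊆ {X = X} {A} {e} X⊆A e∈A f∈ with x∈p∪q⁻ X ⁅ e ⁆ f∈
... | inj₁ f∈X = X⊆A f∈X
... | inj₂ f∈e = subst (_∈ A) (sym (x∈⁅y⁆⇒x≡y e f∈e)) e∈A

-- If the label of `e` were missing from `Y`, then `e` could be added, against maximality. So the
-- maximal rainbow subsets of `A` use exactly the labels occurring on `A`, once each.
maximal-rainbow-meets : ∀ {m n} (ℓ : Fin m → Fin n) {A Y} → MaximalIn (Rainbow ℓ) A Y →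
  ∀ e → e ∈ A → ∃[ f ] f ∈ Y × ℓ e ≡ ℓ f
maximal-rainbow-meets ℓ {A} {Y} (Y⊆A , rainbow , maximal) e e∈A
  with any? (λ f → (f ∈? Y) ×-dec (ℓ e ≟ ℓ f))
... | yes hit = hit
... | no miss = e , e∈Y , refl
  where
  rainbow′ : Rainbow ℓ (Y ∪ ⁅ e ⁆)
  rainbow′ f g f∈ g∈ eq with x∈p∪q⁻ Y ⁅ e ⁆ f∈ | x∈p∪q⁻ Y ⁅ e ⁆ g∈
  ... | inj₁ f∈Y | inj₁ g∈Y = rainbow f g f∈Y g∈Y eq
  ... | inj₁ f∈Y | inj₂ g∈e rewrite x∈⁅y⁆⇒x≡y e g∈e = contradiction (f , f∈Y , sym eq) miss
  ... | inj₂ f∈e | inj₁ g∈Y rewrite x∈⁅y⁆⇒x≡y e f∈e = contradiction (g , g∈Y , eq) miss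
  ... | inj₂ f∈e | inj₂ g∈e = trans (x∈⁅y⁆⇒x≡y e f∈e) (sym (x∈⁅y⁆⇒x≡y e g∈e))

  e∈Y : e ∈ Y
  e∈Y = subst (e ∈_) (maximal (Y ∪ ⁅ e ⁆) (p⊆p∪q ⁅ e ⁆) (∪⁅⁆-⊆ Y⊆A e∈A) rainbow′)
    (q⊆p∪q Y ⁅ e ⁆ (x∈⁅x⁆ e))

rainbow-isMatroid : ∀ {m n} (ℓ : Fin m → Fin n) → IsMatroid (Rainbow ℓ)
rainbow-isMatroid ℓ = record
  { empty    = λ e f e∈⊥ → contradiction e∈⊥ ∉⊥
  ; down     = λ X Y Y⊆X rainbow e f e∈Y f∈Y → rainbow e f (Y⊆X e∈Y) (Y⊆X f∈Y)
  ; equicard = λ A X Y maxX maxY → ≤-antisym (size≤ maxX maxY) (size≤ maxY maxX)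
  }
  where
  size≤ : ∀ {A X Y} → MaximalIn (Rainbow ℓ) A X → MaximalIn (Rainbow ℓ) A Y → ∣ X ∣ ≤ ∣ Y ∣
  size≤ {A} {X} {Y} (X⊆A , rainbow , _) maxY = ∣X∣≤∣Y∣-by-labels ℓ ℓ X Y rainbow
    (λ e e∈X → maximal-rainbow-meets ℓ maxY e (X⊆A e∈X))

-- Four matroids for graphs on at most 12 vertices

-- Entry x of row i is the position of x in the i-th order; found by computer search.
ranks : Vec (Vec ℕ 12) 4
ranks =
  ( 1 ∷  7 ∷ 11 ∷ 9 ∷ 2 ∷ 10 ∷  4 ∷ 6 ∷ 8 ∷  3 ∷  0 ∷  5 ∷ []) ∷
  ( 0 ∷ 10 ∷  6 ∷ 8 ∷ 5 ∷  7 ∷ 11 ∷ 2 ∷ 9 ∷  4 ∷  1 ∷  3 ∷ []) ∷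
  ( 3 ∷  4 ∷  0 ∷ 6 ∷ 9 ∷  5 ∷  2 ∷ 8 ∷ 1 ∷ 10 ∷ 11 ∷  7 ∷ []) ∷
  (11 ∷  4 ∷  0 ∷ 2 ∷ 8 ∷  3 ∷  1 ∷ 9 ∷ 6 ∷  7 ∷  5 ∷ 10 ∷ []) ∷ []

rank : Fin 4 → Fin 12 → ℕ
rank i = lookup (lookup ranks i)

abstract
  ranks-suitable : ∀ x y z → x ≢ y → x ≢ z → ∃[ i ] rank i y < rank i x × rank i z < rank i x
  ranks-suitable = from-yes (all? λ x → all? λ y → all? λ z →
    ¬? (x ≟ y) →-dec (¬? (x ≟ z) →-dec any? λ i → (rank i y <? rank i x) ×-dec (rank i z <? rank i x)))

module UpperEnds (G : Graph) (v≤12 : v G ≤ 12) where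

  height : Fin 4 → Fin (v G) → ℕ
  height i x = rank i (inject≤ x v≤12)

  top : Fin 4 → Fin (m G) → Fin (v G)
  top i e = let (x , y) = ends G e in if does (height i x <? height i y) then y else x

  Joins : Fin (m G) → Fin (v G) → Fin (v G) → Set
  Joins e x y = ends G e ≡ (x , y) ⊎ ends G e ≡ (y , x)

  joins-distinct : ∀ {e x y} → Joins e x y → x ≢ y
  joins-distinct {e} (inj₁ eq) refl = Fin.<-irrefl (trans (cong proj₁ eq) (sym (cong proj₂ eq))) (ordered G e)
  joins-distinct {e} (inj₂ eq) refl = Fin.<-irrefl (trans (cong proj₁ eq) (sym (cong proj₂ eq))) (ordered G e)

  top-joins : ∀ {i e x y} → Joins e x y → height i y < height i x → top i e ≡ x
  top-joins {i} {e} {x} {y} (inj₁ eq) y<x rewrite eq | dec-false (height i x <? height i y) (<-asym y<x) = refl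
  top-joins {i} {e} {x} {y} (inj₂ eq) y<x rewrite eq | dec-true (height i y <? height i x) y<x = refl

  top-incident : ∀ i e → top i e ≡ proj₁ (ends G e) ⊎ top i e ≡ proj₂ (ends G e)
  top-incident i e with does (height i (proj₁ (ends G e)) <? height i (proj₂ (ends G e)))
  ... | true  = inj₂ refl
  ... | false = inj₁ refl

  disjoint⇒top-≢ : ∀ i e f → Disjoint G e f → top i e ≢ top i f
  disjoint⇒top-≢ i e f (d₁₁ , d₁₂ , d₂₁ , d₂₂) eq with top-incident i e | top-incident i f
  ... | inj₁ p | inj₁ q = d₁₁ (trans (sym p) (trans eq q))
  ... | inj₁ p | inj₂ q = d₁₂ (trans (sym p) (trans eq q))
  ... | inj₂ p | inj₁ q = d₂₁ (trans (sym p) (trans eq q))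
  ... | inj₂ p | inj₂ q = d₂₂ (trans (sym p) (trans eq q))

  matching⇒rainbow : ∀ S → IsMatching G S → ∀ i → Rainbow (top i) S
  matching⇒rainbow S matching i e f e∈S f∈S eq = decidable-stable (e ≟ f)
    λ e≢f → disjoint⇒top-≢ i e f (matching e f e∈S f∈S e≢f) eq

  adjacent⇒≡ : ∀ {S e f x y z} → (∀ i → Rainbow (top i) S) → e ∈ S → f ∈ S →
    Joins e x y → Joins f x z → e ≡ f
  adjacent⇒≡ {e = e} {f} {x} {y} {z} rainbow e∈S f∈S e-joins f-joins
    with ranks-suitable (inject≤ x v≤12) (inject≤ y v≤12) (inject≤ z v≤12)
           (joins-distinct e-joins ∘ inject≤-injective v≤12 v≤12 x y)
           (joins-distinct f-joins ∘ inject≤-injective v≤12 v≤12 x z)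
  -- In the `i`-th order `x` is above both other ends, so both edges carry the label `x`.
  ... | i , y<x , z<x = rainbow i e f e∈S f∈S
    (trans (top-joins {i} {e} e-joins y<x) (sym (top-joins {i} {f} f-joins z<x)))

  rainbow⇒matching : ∀ S → (∀ i → Rainbow (top i) S) → IsMatching G S
  rainbow⇒matching S rainbow e f e∈S f∈S e≢f =
    (λ eq → apart (inj₁ refl) (inj₁ (cong (_, y) (sym eq)))) ,
    (λ eq → apart (inj₁ refl) (inj₂ (cong (x ,_) (sym eq)))) ,
    (λ eq → apart (inj₂ refl) (inj₁ (cong (_, y) (sym eq)))) ,
    (λ eq → apart (inj₂ refl) (inj₂ (cong (x ,_) (sym eq))))
    where
    x = proj₁ (ends G f)
    y = proj₂ (ends G f)

    apart : ∀ {x y z} → Joins e x y → Joins f x z → Empty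
    apart e-joins f-joins = e≢f (adjacent⇒≡ rainbow e∈S f∈S e-joins f-joins)

four-matroids-suffice : ∀ G → v G ≤ 12 → IntersectionOf G 4
four-matroids-suffice G v≤12 =
  (λ i → Rainbow (top i)) , (λ i → rainbow-isMatroid (top i)) ,
  λ S → matching⇒rainbow S , rainbow⇒matching S
  where open UpperEnds G v≤12

-- The added matroid `Rainbow id` is the free matroid, which contains every subset. Hence ruling out
-- three matroids also rules out fewer.
intersection-suc : ∀ {G j} → IntersectionOf G j → IntersectionOf G (suc j)
intersection-suc {G} {j} (𝓜 , matroids , char) = 𝓜′ , matroids′ , char′
  where
  𝓜′ : Fin (suc j) → Family (m G)
  𝓜′ zero    = Rainbow id
  𝓜′ (suc i) = 𝓜 i

  matroids′ : ∀ i → IsMatroid (𝓜′ i)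
  matroids′ zero    = rainbow-isMatroid id
  matroids′ (suc i) = matroids i

  char′ : ∀ S → (IsMatching G S → ∀ i → 𝓜′ i S) × ((∀ i → 𝓜′ i S) → IsMatching G S)
  char′ S = to , λ indep → proj₂ (char S) (indep ∘ suc)
    where
    to : IsMatching G S → ∀ i → 𝓜′ i S
    to matching zero    = λ e f _ _ e≡f → e≡f
    to matching (suc i) = proj₁ (char S) matching i

intersection-mono : ∀ {G i j} → i ≤′ j → IntersectionOf G i → IntersectionOf G j
intersection-mono (≤′-reflexive refl) int = int
intersection-mono {G} (≤′-step i≤j) int = intersection-suc {G} (intersection-mono {G} i≤j int)

-- Decidability of being an intersection of j matroids

allSubset? : ∀ {k} {P : Subset k → Set} → Decidable P → Dec (∀ S → P S)
allSubset? P? = map′ (λ ¬∃ S → decidable-stable (P? S) (¬∃ ∘ (S ,_))) (λ ∀P (S , ¬P) → ¬P (∀P S))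
  (¬? (anySubset? (¬? ∘ P?)))

_≟ₛ_ : ∀ {k} (X Y : Subset k) → Dec (X ≡ Y)
_≟ₛ_ = Vec.≡-dec Bool._≟_

maximalIn? : ∀ {k} {𝓜 : Family k} → Decidable 𝓜 → ∀ A X → Dec (MaximalIn 𝓜 A X)
maximalIn? 𝓜? A X = (X ⊆? A) ×-dec 𝓜? X ×-dec
  allSubset? λ Z → (X ⊆? Z) →-dec ((Z ⊆? A) →-dec (𝓜? Z →-dec (Z ≟ₛ X)))

isMatroid? : ∀ {k} {𝓜 : Family k} → Decidable 𝓜 → Dec (IsMatroid 𝓜)
isMatroid? 𝓜? = map′
  (λ (e , d , c) → record { empty = e ; down = d ; equicard = c })
  (λ M → IsMatroid.empty M , IsMatroid.down M , IsMatroid.equicard M)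
  (𝓜? ⊥
   ×-dec (allSubset? λ X → allSubset? λ Y → (Y ⊆? X) →-dec (𝓜? X →-dec 𝓜? Y))
   ×-dec (allSubset? λ A → allSubset? λ X → allSubset? λ Y →
     maximalIn? 𝓜? A X →-dec (maximalIn? 𝓜? A Y →-dec (∣ X ∣ ℕ.≟ ∣ Y ∣))))

disjoint? : ∀ G e f → Dec (Disjoint G e f)
disjoint? G e f = ¬? (_ ≟ _) ×-dec ¬? (_ ≟ _) ×-dec ¬? (_ ≟ _) ×-dec ¬? (_ ≟ _)

isMatching? : ∀ G → Decidable (IsMatching G)
isMatching? G S = all? λ e → all? λ f →
  (e ∈? S) →-dec ((f ∈? S) →-dec (¬? (e ≟ f) →-dec disjoint? G e f))

-- The part of `IntersectionOf` that remains once the families are fixed; it lies in `Set` and is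
-- decidable for decidable families.
IsIntersection : (G : Graph) {j : ℕ} → (Fin j → Family (m G)) → Set
IsIntersection G 𝓜 =
  (∀ i → IsMatroid (𝓜 i)) ×
  (∀ S → (IsMatching G S → ∀ i → 𝓜 i S) × ((∀ i → 𝓜 i S) → IsMatching G S))

isIntersection? : ∀ G {j} {𝓜 : Fin j → Family (m G)} → (∀ i → Decidable (𝓜 i)) → Dec (IsIntersection G 𝓜)
isIntersection? G 𝓜? =
  (all? λ i → isMatroid? (𝓜? i)) ×-dec
  (allSubset? λ S → (isMatching? G S →-dec all? (λ i → 𝓜? i S)) ×-dec
                    (all? (λ i → 𝓜? i S) →-dec isMatching? G S))

maximalIn-resp : ∀ {k} {𝓜 𝓝 : Family k} → (∀ S → 𝓜 S → 𝓝 S) → (∀ S → 𝓝 S → 𝓜 S) →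
  ∀ {A X} → MaximalIn 𝓜 A X → MaximalIn 𝓝 A X
maximalIn-resp to from (X⊆A , indep , maximal) =
  X⊆A , to _ indep , λ Z X⊆Z Z⊆A → maximal Z X⊆Z Z⊆A ∘ from Z

isMatroid-resp : ∀ {k} {𝓜 𝓝 : Family k} → (∀ S → 𝓜 S → 𝓝 S) → (∀ S → 𝓝 S → 𝓜 S) →
  IsMatroid 𝓜 → IsMatroid 𝓝
isMatroid-resp to from M = record
  { empty    = to _ (IsMatroid.empty M)
  ; down     = λ X Y Y⊆X → to Y ∘ IsMatroid.down M X Y Y⊆X ∘ from X
  ; equicard = λ A X Y maxX maxY →
      IsMatroid.equicard M A X Y (maximalIn-resp from to maxX) (maximalIn-resp from to maxY)
  }

isIntersection-resp : ∀ {G j} {𝓜 𝓝 : Fin j → Family (m G)} →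
  (∀ i S → 𝓜 i S → 𝓝 i S) → (∀ i S → 𝓝 i S → 𝓜 i S) → IsIntersection G 𝓜 → IsIntersection G 𝓝
isIntersection-resp to from (matroids , char) =
  (λ i → isMatroid-resp (to i) (from i) (matroids i)) ,
  λ S → (λ matching i → to i S (proj₁ (char S) matching i)) ,
        (λ indep → proj₂ (char S) (λ i → from i S (indep i)))

bit : Bool → Fin 2
bit false = 0F
bit true  = 1F

bit-injective : ∀ b c → bit b ≡ bit c → b ≡ c
bit-injective false false _ = refl
bit-injective true  true  _ = refl

-- Binary numbering of subsets: a tuple of families becomes a subset of a finite index set, over
-- which `anySubset?` can search.
code : ∀ {k} → Subset k → Fin (2 ^ k)
code []      = zero
code (b ∷ S) = combine (bit b) (code S)

code-injective : ∀ {k} (S T : Subset k) → code S ≡ code T → S ≡ T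
code-injective []      []      _  = refl
code-injective (b ∷ S) (c ∷ T) eq =
  let (bit-eq , code-eq) = combine-injective (bit b) (code S) (bit c) (code T) eq in
  cong₂ _∷_ (bit-injective b c bit-eq) (code-injective S T code-eq)

-- A set of codes represents a j-tuple of decidable families.
familiesOf : ∀ j k → Subset (j * 2 ^ k) → Fin j → Family k
familiesOf j k W i S = combine i (code S) ∈ W

familiesOf? : ∀ j k W i → Decidable (familiesOf j k W i)
familiesOf? j k W i S = combine i (code S) ∈? W

comprehension : ∀ {n} {Q : Fin n → Set} → Decidable Q →
  ∃[ W ] (∀ p → p ∈ W → Q p) × (∀ p → Q p → p ∈ W)
comprehension Q? = W , sound , complete
  where
  W : Subset _
  W = tabulate (does ∘ Q?)

  sound : ∀ p → p ∈ W → _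
  sound p p∈W with Q? p | trans (sym (lookup∘tabulate (does ∘ Q?) p)) ([]=⇒lookup p∈W)
  ... | yes q | _  = q
  ... | no _  | ()

  complete : ∀ p → _ → p ∈ W
  complete p q = lookup⇒[]= p W (trans (lookup∘tabulate (does ∘ Q?) p) (dec-true (Q? p) q))

DecidableIntersectionOf : Graph → ℕ → Set
DecidableIntersectionOf G j = ∃[ W ] IsIntersection G (familiesOf j (m G) W)

decidableIntersectionOf? : ∀ G j → Dec (DecidableIntersectionOf G j)
decidableIntersectionOf? G j = anySubset? λ W → isIntersection? G (familiesOf? j (m G) W)

abstract
  -- The conclusion is decidable, hence stable under double negation, so excluded middle may be
  -- assumed for the membership questions.
  intersection⇒decidable : ∀ G j → IntersectionOf G j → DecidableIntersectionOf G j
  intersection⇒decidable G j (𝓜 , int) = decidable-stable (decidableIntersectionOf? G j) λ none →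
    -- There are finitely many codes, so the doubly negated decisions combine into one doubly
    -- negated decision procedure.
    sequence (RawMonad.rawApplicative ¬¬-Monad) {P = λ p → Dec (Q p)} (λ p → ¬¬-excluded-middle) λ Q? →
      let (W , sound , complete) = comprehension Q? in
      none (W , isIntersection-resp {G}
        (λ i S indep → complete _ (i , S , refl , indep))
        (λ i S ∈W → decode i S (sound _ ∈W)) int)
    where
    -- `Q` is the image of the members under the coding; `decode` recovers them by injectivity.
    Q : Fin (j * 2 ^ m G) → Set
    Q p = ∃₂ λ i S → combine i (code S) ≡ p × 𝓜 i S

    decode : ∀ i S → Q (combine i (code S)) → 𝓜 i S
    decode i S (i′ , S′ , eq , indep) with combine-injective i′ (code S′) i (code S) eq
    ... | refl , eq′ rewrite code-injective S′ S eq′ = indep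

decidable-families : ∀ G j → IntersectionOf G j →
  Σ (Fin j → Family (m G)) λ 𝓜 → (∀ i → Decidable (𝓜 i)) × IsIntersection G 𝓜
decidable-families G j int =
  let (W , int′) = intersection⇒decidable G j int in
  familiesOf j (m G) W , familiesOf? j (m G) W , int′

intersectionOf? : ∀ G j → Dec (IntersectionOf G j)
intersectionOf? G j = map′ (λ (W , int) → familiesOf j (m G) W , int) (intersection⇒decidable G j)
  (decidableIntersectionOf? G j)

least-below : ∀ {ℓ} {P : ℕ → Set ℓ} → (∀ i → Dec (P i)) → ∀ n →
  (∃[ i ] i < n × P i × (∀ k → k < i → ¬ P k)) ⊎ (∀ k → k < n → ¬ P k)
least-below P? zero = inj₂ λ _ ()
least-below P? (suc n) with least-below P? n
... | inj₁ (i , i<n , min) = inj₁ (i , m≤n⇒m≤1+n i<n , min)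
... | inj₂ none with P? n
...   | yes Pn = inj₁ (n , ≤-refl , Pn , none)
...   | no ¬Pn = inj₂ λ k k<1+n → [ none k , (λ { refl → ¬Pn }) ] (m<1+n⇒m<n∨m≡n k<1+n)

mu-exists : ∀ G j → IntersectionOf G j → Σ ℕ λ i → MuGraph G i × i ≤ j
-- The search bound is strict, so `suc j` makes it include `j` itself.
mu-exists G j int with least-below (intersectionOf? G) (suc j)
... | inj₁ (i , i<1+j , Pi , min) = i , (Pi , min) , s≤s⁻¹ i<1+j
... | inj₂ none = contradiction int (none j ≤-refl)

-- Parallel elements

pair : ∀ {k} → Fin k → Fin k → Subset k
pair e f = ⁅ e ⁆ ∪ ⁅ f ⁆

∈-pair⁻ : ∀ {k} {e f g : Fin k} → g ∈ pair e f → g ≡ e ⊎ g ≡ f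
∈-pair⁻ {e = e} {f} g∈ with x∈p∪q⁻ ⁅ e ⁆ ⁅ f ⁆ g∈
... | inj₁ g∈e = inj₁ (x∈⁅y⁆⇒x≡y e g∈e)
... | inj₂ g∈f = inj₂ (x∈⁅y⁆⇒x≡y f g∈f)

∈-pairˡ : ∀ {k} {e f : Fin k} → e ∈ pair e f
∈-pairˡ {e = e} = x∈p∪q⁺ (inj₁ (x∈⁅x⁆ e))

∈-pairʳ : ∀ {k} {e f : Fin k} → f ∈ pair e f
∈-pairʳ {f = f} = x∈p∪q⁺ (inj₂ (x∈⁅x⁆ f))

pair-⊆ : ∀ {k} {e f : Fin k} {A} → e ∈ A → f ∈ A → pair e f ⊆ A
pair-⊆ e∈A f∈A g∈ with ∈-pair⁻ g∈
... | inj₁ refl = e∈A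
... | inj₂ refl = f∈A

module Parallelism {k} (𝓜 : Family k) (M : IsMatroid 𝓜) (loopless : ∀ e → 𝓜 ⁅ e ⁆) where
  open IsMatroid M

  -- Equality is a separate case because `pair e e` is a singleton, which is independent here.
  Parallel : Fin k → Fin k → Set
  Parallel e f = e ≡ f ⊎ ¬ 𝓜 (pair e f)

  parallel-sym : ∀ {e f} → Parallel e f → Parallel f e
  parallel-sym (inj₁ e≡f) = inj₁ (sym e≡f)
  parallel-sym (inj₂ dep) = inj₂ (dep ∘ down _ _ (pair-⊆ ∈-pairʳ ∈-pairˡ))

  -- If {e, g} were independent, then {f} and {e, g} would be maximal in {e, f, g}.
  dependent-trans : ∀ {e f g} → e ≢ g → ¬ 𝓜 (pair e f) → ¬ 𝓜 (pair f g) → ¬ 𝓜 (pair e g)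
  dependent-trans {e} {f} {g} e≢g dep-ef dep-fg indep-eg =
    <-irrefl (trans (∣⁅x⁆∣≡1 e) (trans (sym (∣⁅x⁆∣≡1 f)) (equicard A ⁅ f ⁆ (pair e g) max-f max-eg)))
      (p⊂q⇒∣p∣<∣q∣ (p⊆p∪q ⁅ g ⁆ , g , ∈-pairʳ , λ g∈e → e≢g (sym (x∈⁅y⁆⇒x≡y e g∈e))))
    where
    A : Subset k
    A = pair e g ∪ ⁅ f ⁆

    ∈A⁻ : ∀ {h} → h ∈ A → (h ≡ e ⊎ h ≡ g) ⊎ h ≡ f
    ∈A⁻ h∈A with x∈p∪q⁻ (pair e g) ⁅ f ⁆ h∈A
    ... | inj₁ h∈eg = inj₁ (∈-pair⁻ h∈eg)
    ... | inj₂ h∈f  = inj₂ (x∈⁅y⁆⇒x≡y f h∈f)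

    max-f : MaximalIn 𝓜 A ⁅ f ⁆
    max-f = q⊆p∪q (pair e g) ⁅ f ⁆ , loopless f , λ Z f⊆Z Z⊆A indep → ⊆-antisym (shrink Z f⊆Z Z⊆A indep) f⊆Z
      where
      shrink : ∀ Z → ⁅ f ⁆ ⊆ Z → Z ⊆ A → 𝓜 Z → Z ⊆ ⁅ f ⁆
      shrink Z f⊆Z Z⊆A indep h∈Z with ∈A⁻ (Z⊆A h∈Z)
      ... | inj₁ (inj₁ refl) = contradiction (down Z _ (pair-⊆ h∈Z (f⊆Z (x∈⁅x⁆ f))) indep) dep-ef
      ... | inj₁ (inj₂ refl) = contradiction (down Z _ (pair-⊆ (f⊆Z (x∈⁅x⁆ f)) h∈Z) indep) dep-fg
      ... | inj₂ refl        = x∈⁅x⁆ f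

    max-eg : MaximalIn 𝓜 A (pair e g)
    max-eg = p⊆p∪q ⁅ f ⁆ , indep-eg , λ Z eg⊆Z Z⊆A indep → ⊆-antisym (shrink Z eg⊆Z Z⊆A indep) eg⊆Z
      where
      shrink : ∀ Z → pair e g ⊆ Z → Z ⊆ A → 𝓜 Z → Z ⊆ pair e g
      shrink Z eg⊆Z Z⊆A indep h∈Z with ∈A⁻ (Z⊆A h∈Z)
      ... | inj₁ (inj₁ refl) = ∈-pairˡ
      ... | inj₁ (inj₂ refl) = ∈-pairʳ
      ... | inj₂ refl        = contradiction (down Z _ (pair-⊆ (eg⊆Z ∈-pairˡ) h∈Z) indep) dep-ef

  parallel-trans : ∀ {e f g} → Parallel e f → Parallel f g → Parallel e g
  parallel-trans (inj₁ refl) q = q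
  parallel-trans p (inj₁ refl) = p
  parallel-trans {e} {f} {g} (inj₂ p) (inj₂ q) with e ≟ g
  ... | yes e≡g = inj₁ e≡g
  ... | no  e≢g = inj₂ (dependent-trans e≢g p q)

  parallel? : Decidable 𝓜 → ∀ e f → Dec (Parallel e f)
  parallel? 𝓜? e f = (e ≟ f) ⊎-dec ¬? (𝓜? (pair e f))

-- Three colours do not suffice on five vertices

unique? : ∀ {n} (xs : List (Fin n)) → Dec (Unique xs)
unique? = DecUnique.unique? _≟_

-- C i x y z means that the edges xy and xz are parallel in the i-th matroid.
record CherryColouring (C : Fin 3 → Fin 5 → Fin 5 → Fin 5 → Set) : Set where
  field
    reflexive  : ∀ {i x y} → C i x y y
    symmetric  : ∀ {i x y z} → C i x y z → C i x z y
    transitive : ∀ {i x y z w} → C i x y z → C i x z w → C i x y w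
    conflict   : ∀ {i x y z w} → Unique (x ∷ y ∷ z ∷ w ∷ []) → C i x y z → ¬ C i y x w
    covered    : ∀ {x y z} → Unique (x ∷ y ∷ z ∷ []) → ∃[ i ] C i x y z

Injection : ∀ {n} → (Fin n → Fin n) → Set
Injection σ = ∀ x y → σ x ≡ σ y → x ≡ y

Surjection : ∀ {n} → (Fin n → Fin n) → Set
Surjection π = ∀ i → ∃[ j ] π j ≡ i

injection? : ∀ {n} → Decidable (Injection {n})
injection? σ = all? λ x → all? λ y → (σ x ≟ σ y) →-dec (x ≟ y)

surjection? : ∀ {n} → Decidable (Surjection {n})
surjection? π = all? λ i → any? λ j → π j ≟ i

-- Used to bring colour patterns into normal form. Injectivity of `σ` keeps vertices distinct;
-- surjectivity of `π` lets every covering colour be renamed.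
relabel : ∀ {C} (π : Fin 3 → Fin 3) (σ : Fin 5 → Fin 5) → Surjection π → Injection σ →
  CherryColouring C → CherryColouring (λ i x y z → C (π i) (σ x) (σ y) (σ z))
relabel {C} π σ surj inj K = record
  { reflexive  = reflexive
  ; symmetric  = symmetric
  ; transitive = transitive
  ; conflict   = λ u → conflict (Unique.map⁺ (inj _ _) u)
  ; covered    = λ u → recolour (covered (Unique.map⁺ (inj _ _) u))
  }
  where
  open CherryColouring K

  recolour : ∀ {x y z} → ∃[ i ] C i x y z → ∃[ j ] C (π j) x y z
  recolour (i , p) with surj i
  ... | j , refl = j , p

module LocalAnalysis {C} (K : CherryColouring C) where
  open CherryColouring K renaming (symmetric to symm; transitive to tran)

  pattern u = 0F
  pattern v′ = 1F
  pattern a = 2F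
  pattern b = 3F
  pattern c = 4F

  -- For literal vertices the distinctness proof is found by evaluation.
  clash : ∀ x y z w {_ : True (unique? (x ∷ y ∷ z ∷ w ∷ []))} {i} → C i x y z → C i y x w → Empty
  clash x y z w {t} = conflict (toWitness t)

  colour-0 : ∀ x y z {_ : True (unique? (x ∷ y ∷ z ∷ []))} → ¬ C 1F x y z → ¬ C 2F x y z → C 0F x y z
  colour-0 x y z {t} not-1 not-2 with covered (toWitness t)
  ... | 0F , p = p
  ... | 1F , p = contradiction p not-1
  ... | 2F , p = contradiction p not-2

  colour-1 : ∀ x y z {_ : True (unique? (x ∷ y ∷ z ∷ []))} → ¬ C 0F x y z → ¬ C 2F x y z → C 1F x y z
  colour-1 x y z {t} not-0 not-2 with covered (toWitness t)
  ... | 0F , p = contradiction p not-0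
  ... | 1F , p = p
  ... | 2F , p = contradiction p not-2

  colour-2 : ∀ x y z {_ : True (unique? (x ∷ y ∷ z ∷ []))} → ¬ C 0F x y z → ¬ C 1F x y z → C 2F x y z
  colour-2 x y z {t} not-0 not-1 with covered (toWitness t)
  ... | 0F , p = contradiction p not-0
  ... | 1F , p = contradiction p not-1
  ... | 2F , p = p

  -- Meant for the two ends of the edge `u` `v′`. By transitivity, the three pairs containing that
  -- edge decide whether the whole star is parallel.
  NoFullStarAt : Fin 5 → Fin 5 → Set
  NoFullStarAt x y = ∀ i → C i x y a → C i x y b → ¬ C i x y c

  -- The conflicts force the pairs at `v′` to repeat the colours at `u`, so each matroid has a
  -- parallel triangle on `u` `v′`. Further forced colours make `a` `v′` and `u` `b` parallel to `a`
  -- `u` in matroid 2, although they are disjoint.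
  three-triangles : C 0F u v′ a → C 1F u v′ b → C 2F u v′ c → Empty
  three-triangles uva uvb uvc = clash a u v′ b (tran aub (symm avb)) uab
    where
    vua : C 0F v′ u a
    vua = colour-0 v′ u a (clash u v′ b a uvb) (clash u v′ c a uvc)

    vub : C 1F v′ u b
    vub = colour-1 v′ u b (clash u v′ a b uva) (clash u v′ c b uvc)

    vuc : C 2F v′ u c
    vuc = colour-2 v′ u c (clash u v′ a c uva) (clash u v′ b c uvb)

    uab : C 2F u a b
    uab = colour-2 u a b (λ p → clash u v′ b a (tran uva p) vua) (λ p → clash u v′ a b (tran uvb (symm p)) vub)

    uac : C 1F u a c
    uac = colour-1 u a c (λ p → clash u v′ c a (tran uva p) vua) (λ p → clash u v′ a c (tran uvc (symm p)) vuc)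

    vac : C 1F v′ a c
    vac = colour-1 v′ a c (λ p → clash v′ u c a (tran vua p) uva) (λ p → clash v′ u a c (tran vuc (symm p)) uvc)

    aub : C 2F a u b
    aub = colour-2 a u b (λ p → clash a u b v′ p (symm uva)) (λ p → clash a u b c p uac)

    avb : C 2F a v′ b
    avb = colour-2 a v′ b (λ p → clash a v′ b u p (symm vua)) (λ p → clash a v′ b c p vac)

  -- Here matroid 0 gets a parallel triangle `u` `v′` `a`, while matroids 1 and 2 get three parallel
  -- edges at `u` and at `v′`, to `b`, `c` and the other end. The absence of full stars fixes the
  -- remaining colours, until the disjoint edges `b` `a` and `c` `u` are both parallel to `b` `c` in
  -- matroid 0.
  triangle-and-two-stars : NoFullStarAt u v′ → NoFullStarAt v′ u →
    C 0F u v′ a → C 1F u v′ b → C 1F u v′ c → Empty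
  triangle-and-two-stars not-full-u not-full-v uva uvb uvc =
    clash b c a u (tran (symm buc) (symm bau)) (symm cub)
    where
    vub : C 2F v′ u b
    vub = colour-2 v′ u b (clash u v′ a b uva) (clash u v′ c b uvc)

    vuc : C 2F v′ u c
    vuc = colour-2 v′ u c (clash u v′ a c uva) (clash u v′ b c uvb)

    vua : C 0F v′ u a
    vua = colour-0 v′ u a (clash u v′ b a uvb) (λ p → not-full-v 2F p vub vuc)

    uab : C 2F u a b
    uab = colour-2 u a b (λ p → clash u v′ b a (tran uva p) vua) (λ p → not-full-u 1F (tran uvb (symm p)) uvb uvc)

    uac : C 2F u a c
    uac = colour-2 u a c (λ p → clash u v′ c a (tran uva p) vua) (λ p → not-full-u 1F (tran uvc (symm p)) uvb uvc)

    vac : C 1F v′ a c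
    vac = colour-1 v′ a c (λ p → clash v′ u c a (tran vua p) uva) (λ p → not-full-v 2F (tran vuc (symm p)) vub vuc)

    avb : C 2F a v′ b
    avb = colour-2 a v′ b (λ p → clash a v′ b u p (symm vua)) (λ p → clash a v′ b c p vac)

    bau : C 0F b a u
    bau = colour-0 b a u (λ p → clash b u a v′ (symm p) (symm uvb)) (λ p → clash b a u v′ p (symm avb))

    buc : C 0F b u c
    buc = colour-0 b u c (λ p → clash b u c v′ p (symm uvb)) (λ p → clash b u c a p (symm uab))

    cub : C 0F c u b
    cub = colour-0 c u b (λ p → clash c u b v′ p (symm uvc)) (λ p → clash c u b a p (symm uac))

abstract
  third-colour : ∀ p q → p ≢ q → ∃[ r ] Surjection (lookup (p ∷ q ∷ r ∷ []))
  third-colour = from-yes (all? λ p → all? λ q → ¬? (p ≟ q) →-dec any? λ r → surjection? (lookup (p ∷ q ∷ r ∷ [])))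

abstract
  distinct-colours : ∀ (p q r : Fin 3) → p ≢ q → q ≢ r → p ≢ r → Surjection (lookup (p ∷ q ∷ r ∷ []))
  distinct-colours = from-yes (all? λ p → all? λ q → all? λ r →
    ¬? (p ≟ q) →-dec (¬? (q ≟ r) →-dec (¬? (p ≟ r) →-dec surjection? (lookup (p ∷ q ∷ r ∷ [])))))

module _ {C} (K : CherryColouring C) where
  open CherryColouring K
  open LocalAnalysis using (NoFullStarAt; three-triangles; triangle-and-two-stars)

  edge-has-full-star : NoFullStarAt K 0F 1F → ¬ NoFullStarAt K 1F 0F
  edge-has-full-star not-full-u not-full-v
    with covered {0F} {1F} {2F} (from-yes (unique? (0F ∷ 1F ∷ 2F ∷ [])))
       | covered {0F} {1F} {3F} (from-yes (unique? (0F ∷ 1F ∷ 3F ∷ [])))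
       | covered {0F} {1F} {4F} (from-yes (unique? (0F ∷ 1F ∷ 4F ∷ [])))
  -- Three equal colours give a full star at 0; if exactly two agree, the odd vertex is moved to
  -- position `a`; three different colours give the triangle case.
  ... | p , uva | q , uvb | r , uvc with p ≟ q | q ≟ r | p ≟ r
  ... | yes refl | yes refl | _ = not-full-u p uva uvb uvc
  ... | yes refl | no p≢r | _ with third-colour r p (p≢r ∘ sym)
  ...   | s , surj = triangle-and-two-stars (relabel (lookup (r ∷ p ∷ s ∷ [])) σ surj (from-yes (injection? σ)) K)
          (λ i x y z → not-full-u _ y z x) (λ i x y z → not-full-v _ y z x) uvc uva uvb
    where
    σ : Fin 5 → Fin 5
    σ = lookup (0F ∷ 1F ∷ 4F ∷ 2F ∷ 3F ∷ [])
  edge-has-full-star not-full-u not-full-v | p , uva | q , uvb | r , uvc | no p≢q | yes refl | _ with third-colour p q p≢q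
  ...   | s , surj = triangle-and-two-stars (relabel (lookup (p ∷ q ∷ s ∷ [])) id surj (λ _ _ eq → eq) K)
          (λ i → not-full-u _) (λ i → not-full-v _) uva uvb uvc
  edge-has-full-star not-full-u not-full-v | p , uva | q , uvb | r , uvc | no p≢q | no q≢r | yes refl with third-colour q p (p≢q ∘ sym)
  ...   | s , surj = triangle-and-two-stars (relabel (lookup (q ∷ p ∷ s ∷ [])) σ surj (from-yes (injection? σ)) K)
          (λ i x y z → not-full-u _ y x z) (λ i x y z → not-full-v _ y x z) uvb uva uvc
    where
    σ : Fin 5 → Fin 5
    σ = lookup (0F ∷ 1F ∷ 3F ∷ 2F ∷ 4F ∷ [])
  edge-has-full-star not-full-u not-full-v | p , uva | q , uvb | r , uvc | no p≢q | no q≢r | no p≢r =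
    three-triangles (relabel (lookup (p ∷ q ∷ r ∷ [])) id (distinct-colours p q r p≢q q≢r p≢r) (λ _ _ eq → eq) K)
      uva uvb uvc

abstract
  remaining-vertices : ∀ x y → x ≢ y → ∃[ a ] ∃[ b ] ∃[ c ]
    let σ = lookup (x ∷ y ∷ a ∷ b ∷ c ∷ []) in Injection {5} σ × Surjection σ
  remaining-vertices = from-yes (all? λ x → all? λ y → ¬? (x ≟ y) →-dec any? λ a → any? λ b → any? λ c →
    let σ = lookup (x ∷ y ∷ a ∷ b ∷ c ∷ []) in injection? σ ×-dec surjection? σ)

module _ {C} (K : CherryColouring C) (C? : ∀ i x y z → Dec (C i x y z)) where
  open CherryColouring K

  -- One reference edge suffices: by symmetry and transitivity all edges at `x` are then parallel to
  -- each other.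
  FullStar : Fin 3 → Fin 5 → Set
  FullStar i x = ∃[ y ] ∀ z → z ≢ x → C i x y z

  fullStar? : ∀ x → Dec (∃[ i ] FullStar i x)
  fullStar? x = any? λ i → any? λ y → all? λ z → ¬? (z ≟ x) →-dec C? i x y z

  -- The edge joining `x` and `y` lies in both stars, so it would link an edge at `x` to a disjoint
  -- edge at `y`.
  full-star-unique : ∀ {i x y} → x ≢ y → FullStar i x → ¬ FullStar i y
  full-star-unique {i} {x} {y} x≢y (s , full-x) (t , full-y) with remaining-vertices x y x≢y
  ... | a , b , c , inj , _ = CherryColouring.conflict (relabel id σ (λ i → i , refl) inj K)
          {i} {0F} {1F} {2F} {3F} (from-yes (unique? (0F ∷ 1F ∷ 2F ∷ 3F ∷ [])))
          (transitive (symmetric (full-x y (x≢y ∘ sym))) (full-x a (apart 2F 0F λ ())))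
          (transitive (symmetric (full-y x x≢y)) (full-y b (apart 3F 1F λ ())))
    where
    σ : Fin 5 → Fin 5
    σ = lookup (x ∷ y ∷ a ∷ b ∷ c ∷ [])

    apart : ∀ p q → p ≢ q → σ p ≢ σ q
    apart p q p≢q = p≢q ∘ inj p q

  full-star-at-end : ∀ x y → x ≢ y → ¬ (∃[ i ] FullStar i x) → ∃[ i ] FullStar i y
  full-star-at-end x y x≢y not-full-x = decidable-stable (fullStar? y) λ not-full-y →
    let (a , b , c , inj , surj) = remaining-vertices x y x≢y
        σ = lookup (x ∷ y ∷ a ∷ b ∷ c ∷ [])
    in edge-has-full-star (relabel id σ (λ i → i , refl) inj K)
         (λ i p q r → not-full-x (i , y , star₀ surj p q r))
         (λ i p q r → not-full-y (i , x , star₁ surj p q r))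
    where
    star₀ : ∀ {a b c i} → Surjection (lookup (x ∷ y ∷ a ∷ b ∷ c ∷ [])) →
      C i x y a → C i x y b → C i x y c → ∀ z → z ≢ x → C i x y z
    star₀ surj p q r z z≢x with surj z
    ... | 0F , refl = contradiction refl z≢x
    ... | 1F , refl = reflexive
    ... | 2F , refl = p
    ... | 3F , refl = q
    ... | 4F , refl = r

    star₁ : ∀ {a b c i} → Surjection (lookup (x ∷ y ∷ a ∷ b ∷ c ∷ [])) →
      C i y x a → C i y x b → C i y x c → ∀ z → z ≢ y → C i y x z
    star₁ surj p q r z z≢y with surj z
    ... | 0F , refl = reflexive
    ... | 1F , refl = contradiction refl z≢y
    ... | 2F , refl = p
    ... | 3F , refl = q
    ... | 4F , refl = r

  full-stars-but-one : ∃[ x ] ∀ y → x ≢ y → ∃[ i ] FullStar i y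
  full-stars-but-one with any? (¬? ∘ fullStar?)
  ... | yes (x , not-full) = x , λ y x≢y → full-star-at-end x y x≢y not-full
  ... | no all-full        = 0F , λ y _ → decidable-stable (fullStar? y) (all-full ∘ (y ,_))

  no-colouring : Empty
  no-colouring with full-stars-but-one
  -- `punchIn x` lists the four vertices other than `x`; each has a full star in one of only three
  -- matroids.
  ... | x , full with pigeonhole {3} {4} ≤-refl (λ p → proj₁ (full (punchIn x p) (punchInᵢ≢i x p ∘ sym)))
  ...   | p , q , p<q , eq = full-star-unique
          (λ same → Fin.<-irrefl (punchIn-injective x p q same) p<q)
          (proj₂ (full (punchIn x p) _))
          (subst (λ i → FullStar i (punchIn x q)) (sym eq) (proj₂ (full (punchIn x q) _)))

-- The complete graph on five vertices

K₅ : Graph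
K₅ = record
  { v       = 5
  ; m       = 10
  ; ends    = ends₅
  ; ordered = from-yes (all? λ e → proj₁ (ends₅ e) Fin.<? proj₂ (ends₅ e))
  ; simple  = from-yes (all? λ e → all? λ f → ≡-dec _≟_ _≟_ (ends₅ e) (ends₅ f) →-dec (e ≟ f))
  }
  where
  ends₅ : Fin 10 → Fin 5 × Fin 5
  ends₅ = lookup ((0F , 1F) ∷ (0F , 2F) ∷ (0F , 3F) ∷ (0F , 4F) ∷ (1F , 2F) ∷
                  (1F , 3F) ∷ (1F , 4F) ∷ (2F , 3F) ∷ (2F , 4F) ∷ (3F , 4F) ∷ [])

-- The diagonal entries are junk.
edge : Fin 5 → Fin 5 → Fin 10
edge x y = lookup (lookup table x) y
  where
  table : Vec (Vec (Fin 10) 5) 5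
  table = (0F ∷ 0F ∷ 1F ∷ 2F ∷ 3F ∷ []) ∷
          (0F ∷ 0F ∷ 4F ∷ 5F ∷ 6F ∷ []) ∷
          (1F ∷ 4F ∷ 0F ∷ 7F ∷ 8F ∷ []) ∷
          (2F ∷ 5F ∷ 7F ∷ 0F ∷ 9F ∷ []) ∷
          (3F ∷ 6F ∷ 8F ∷ 9F ∷ 0F ∷ []) ∷ []

abstract
  edge-comm : ∀ x y → edge x y ≡ edge y x
  edge-comm = from-yes (all? λ x → all? λ y → edge x y ≟ edge y x)

abstract
  edge-adjacent : ∀ x y z → Unique (x ∷ y ∷ z ∷ []) →
    edge x y ≢ edge x z × ¬ Disjoint K₅ (edge x y) (edge x z)
  edge-adjacent = from-yes (all? λ x → all? λ y → all? λ z → unique? (x ∷ y ∷ z ∷ []) →-dec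
    (¬? (edge x y ≟ edge x z) ×-dec ¬? (disjoint? K₅ (edge x y) (edge x z))))

abstract
  edge-disjoint : ∀ x y z w → Unique (x ∷ y ∷ z ∷ w ∷ []) →
    edge x z ≢ edge y w × Disjoint K₅ (edge x z) (edge y w)
  edge-disjoint = from-yes (all? λ x → all? λ y → all? λ z → all? λ w → unique? (x ∷ y ∷ z ∷ w ∷ []) →-dec
    (¬? (edge x z ≟ edge y w) ×-dec disjoint? K₅ (edge x z) (edge y w)))

singleton-isMatching : ∀ G e → IsMatching G ⁅ e ⁆
singleton-isMatching G e f g f∈ g∈ f≢g =
  contradiction (trans (x∈⁅y⁆⇒x≡y e f∈) (sym (x∈⁅y⁆⇒x≡y e g∈))) f≢g

disjoint-sym : ∀ G {e f} → Disjoint G e f → Disjoint G f e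
disjoint-sym G (d₁₁ , d₁₂ , d₂₁ , d₂₂) = d₁₁ ∘ sym , d₂₁ ∘ sym , d₁₂ ∘ sym , d₂₂ ∘ sym

pair-isMatching : ∀ G {e f} → Disjoint G e f → IsMatching G (pair e f)
pair-isMatching G disj g h g∈ h∈ g≢h with ∈-pair⁻ g∈ | ∈-pair⁻ h∈
... | inj₁ refl | inj₁ refl = contradiction refl g≢h
... | inj₁ refl | inj₂ refl = disj
... | inj₂ refl | inj₁ refl = disjoint-sym G disj
... | inj₂ refl | inj₂ refl = contradiction refl g≢h

K₅-needs-four : ¬ IntersectionOf K₅ 3
K₅-needs-four int with decidable-families K₅ 3 int
... | 𝓜 , 𝓜? , matroids , char = no-colouring {C} colouring λ i x y z → parallel? i (𝓜? i) _ _
  where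
  module P (i : Fin 3) = Parallelism (𝓜 i) (matroids i)
    (λ e → proj₁ (char ⁅ e ⁆) (singleton-isMatching K₅ e) i)
  open P

  C : Fin 3 → Fin 5 → Fin 5 → Fin 5 → Set
  C i x y z = Parallel i (edge x y) (edge x z)

  colouring : CherryColouring C
  colouring = record
    { reflexive  = inj₁ refl
    ; symmetric  = λ {i} → parallel-sym i
    ; transitive = λ {i} → parallel-trans i
    -- Both given edges are parallel to the edge `xy`, hence to each other, but they are disjoint
    -- and so form a matching.
    ; conflict   = λ {i} {x} {y} {z} {w} uniq xy∥xz yx∥yw → not-parallel {i} (edge-disjoint x y z w uniq)
        (parallel-trans i (parallel-sym i xy∥xz) (subst (λ e → Parallel i e (edge y w)) (edge-comm y x) yx∥yw))
    ; covered    = λ {x} {y} {z} uniq → some-parallel (edge-adjacent x y z uniq)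
    }
    where
    not-parallel : ∀ {i e f} → e ≢ f × Disjoint K₅ e f → ¬ Parallel i e f
    not-parallel (e≢f , _) (inj₁ e≡f) = e≢f e≡f
    not-parallel {i} {e} {f} (_ , disj) (inj₂ dep) = dep (proj₁ (char (pair e f)) (pair-isMatching K₅ {e} {f} disj) i)

    some-parallel : ∀ {e f} → e ≢ f × ¬ Disjoint K₅ e f → ∃[ i ] Parallel i e f
    some-parallel {e} {f} (e≢f , meet)
      -- Two meeting edges are no matching, so some matroid rejects the pair; decidability of the
      -- families lets it be found.
      with ¬∀⟶∃¬ 3 _ (λ i → 𝓜? i (pair e f))
             (λ indep → meet (proj₂ (char (pair e f)) indep e f ∈-pairˡ ∈-pairʳ e≢f))
    ... | i , dep = i , inj₂ dep

mu-K₅ : MuGraph K₅ 4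
mu-K₅ = four-matroids-suffice K₅ (s≤s (s≤s (s≤s (s≤s (s≤s z≤n))))) ,
  λ i i<4 int → K₅-needs-four (intersection-mono {K₅} (≤⇒≤′ (s≤s⁻¹ i<4)) int)

theorem6 : ∀ n → 5 ≤ n → n ≤ 12 → MuN n 4
theorem6 n 5≤n n≤12 =
  (λ G v≤n → mu-exists G 4 (four-matroids-suffice G (≤-trans v≤n n≤12))) ,
  (K₅ , 5≤n , mu-K₅)
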